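{- Let $(G,+)$ be a commutative cancellative semigroup. Then there exists a partition $G=A_0\cup A_1$ of $G$ into two cells such that there is no uncountable $X\subseteq G$ and no $i\in 2$ with $\mathrm{FS}(X)\subseteq A_i$. In particular, $\mathrm{Hind}(G,\lambda)$ fails for every uncountable cardinal $\lambda$.
   Context: For $X\subseteq G$, $\mathrm{FS}(X)=\{\sum_{x\in F}x : F\subseteq X \text{ finite and nonempty}\}$ denotes the set of finite sums of (distinct) elements of $X$. For a commutative semigroup $G$ and a cardinal $\lambda$, $\mathrm{Hind}(G,\lambda)$ is the statement: for every partition $G=A_0\cup A_1$ into two cells there exist a set $X\subseteq G$ of cardinality $\lambda$ and an $i\in 2$ with $\mathrm{FS}(X)\subseteq A_i$. -}

module Defs where

open import Algebra.Bundles using (CommutativeSemigroup)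
open import Data.Fin.Base using (Fin)
open import Data.List.NonEmpty.Base using (List⁺; foldr₁; toList)
open import Data.List.Relation.Unary.All using (All)
import Data.List.Relation.Unary.Unique.Setoid as Unique
open import Data.Nat.Base using (ℕ)
open import Data.Product.Base using (Σ; Σ-syntax; ∃-syntax; _×_; proj₁)
open import Function.Bundles using (Injection; Bijection)
open import Level using (Level; _⊔_; suc)
open import Relation.Binary.Bundles using (Setoid)
open import Relation.Binary.Definitions using (_Respects_)
import Relation.Binary.Construct.On as On
open import Relation.Binary.PropositionalEquality.Core using (_≡_)
open import Relation.Binary.PropositionalEquality.Properties using (setoid)
open import Relation.Nullary.Negation.Core using (¬_)
open import Relation.Unary using (Pred; _∈_; _⊆_)

private
  variable
    c ℓ : Level

-- Zermelo's axiom of choice: every partition has a transversal, i.e. every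
-- equivalence relation has a choice of one representative per class.  The
-- content is that equivalent elements get the same (_≡_) representative;
-- choice for Σ-types is provable in type theory and does not yield this.
AxiomOfChoice : (c ℓ : Level) → Set (suc (c ⊔ ℓ))
AxiomOfChoice c ℓ = (S : Setoid c ℓ) → let open Setoid S in
  Σ[ rep ∈ (Carrier → Carrier) ]
    ((∀ x → rep x ≈ x) × (∀ {x y} → x ≈ y → rep x ≡ rep y))

Countable : Setoid c ℓ → Set (c ⊔ ℓ)
Countable S = Injection S (setoid ℕ)

Uncountable : Setoid c ℓ → Set (c ⊔ ℓ)
Uncountable S = ¬ Countable S

record Subset (S : Setoid c ℓ) (p : Level) : Set (c ⊔ ℓ ⊔ suc p) where
  open Setoid S
  field
    member   : Pred Carrier p
    respects : member Respects _≈_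

  -- Elements are compared in S, disregarding membership proofs.
  asSetoid : Setoid (c ⊔ p) ℓ
  asSetoid = On.setoid {B = Σ Carrier member} S proj₁

-- Cells may be empty, as is usual for colourings.
record Partition₂ (S : Setoid c ℓ) (a : Level) : Set (c ⊔ ℓ ⊔ suc a) where
  open Setoid S
  field
    cell     : Fin 2 → Pred Carrier a
    respects : ∀ i → cell i Respects _≈_
    covers   : ∀ x → ∃[ i ] x ∈ cell i
    disjoint : ∀ {x i j} → x ∈ cell i → x ∈ cell j → i ≡ j

module _ (G : CommutativeSemigroup c ℓ) where
  open CommutativeSemigroup G renaming (setoid to S)
  open Unique S using (Unique)

  -- A finite nonempty F ⊆ X is listed without repetition; by commutativity
  -- the order of the list does not affect the sum up to _≈_.
  FS : ∀ {p} → Subset S p → Pred Carrier (c ⊔ ℓ ⊔ p)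
  FS X y = Σ[ F ∈ List⁺ Carrier ]
    (Unique (toList F) × All (Subset.member X) (toList F) × y ≈ foldr₁ _∙_ F)

  -- A cardinal is given by a setoid of that cardinality; a and p are the
  -- universe levels of the cells and of X.
  Hind : ∀ {s t} (a p : Level) → Setoid s t → Set (c ⊔ ℓ ⊔ s ⊔ t ⊔ suc (a ⊔ p))
  Hind a p Λ = (A : Partition₂ S a) →
    Σ[ X ∈ Subset S p ] (Bijection (Subset.asSetoid X) Λ ×
      (∃[ i ] (FS X ⊆ Partition₂.cell A i)))

{-# OPTIONS --safe #-}
module Submission where

-- Well-order G and embed it in its group of differences A.  Call a set P of
-- elements of G closed if, for every x in P, each multiple of x generated by
-- the predecessors of x is generated by the predecessors of x lying in P.
-- Closed sets are stable under unions and intersections, ⟨P ∩ Q⟩ is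
-- ⟨P⟩ ∩ ⟨Q⟩ for closed P and Q, and every element lies in a finite closed set:
-- ℤ being Noetherian, x brings in only finitely many predecessors, and then one
-- recurses.  So each x has a least finite closed set supp x generating it, with
-- supp (x + y) ⊆ supp x ∪ supp y and supp x ⊆ supp (x + y) ∪ supp y, and only
-- countably many x have their support inside a given finite set.
--
-- Colour x by the parity of ⌊log₂ |supp x|⌋.  If X is uncountable, then
-- uncountably many x ∈ X have supports of one size n; take a finite R maximal
-- subject to being contained in uncountably many of those.  By maximality one
-- can keep choosing such x whose support meets that of the sum σ chosen so far
-- only inside R and is not contained in R.  Adding x to σ then raises |supp σ|
-- by at most n, while |supp σ| tends to infinity, so no large dyadic interval
-- is skipped and both colours occur.

open import Defs
open import Algebra.Bundles using (AbelianGroup; CommutativeSemigroup)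
open import Algebra.Definitions using (Cancellative)
import Algebra.Properties.AbelianGroup as AbelianGroupProperties
import Algebra.Properties.CommutativeSemigroup as CommutativeSemigroupProperties
import Algebra.Properties.Monoid.Mult as Mult
open import Axiom.ExcludedMiddle using (ExcludedMiddle)
open import Data.Bool.Base using (Bool; T)
open import Data.Empty using (⊥)
open import Data.Fin.Base using (Fin; zero; suc; opposite)
open import Data.List.Base using (List; []; _∷_; _++_; length; filter)
open import Data.List.Membership.Propositional using (_∈_; _∉_; lose)
open import Data.List.Membership.Propositional.Properties using (∈-++⁺ˡ; ∈-++⁺ʳ; ∈-++⁻; ∈-filter⁺; ∈-filter⁻)
open import Data.List.NonEmpty.Base using (List⁺; foldr₁; toList; _∷⁺_; [_])
open import Data.List.Properties using (filter-notAll; length-++)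
open import Data.List.Relation.Unary.All using (All; []; _∷_)
import Data.List.Relation.Unary.All as All
import Data.List.Relation.Unary.All.Properties as All
open import Data.List.Relation.Unary.AllPairs using ([]; _∷_)
open import Data.List.Relation.Unary.Any using (here; there)
open import Data.List.Relation.Unary.Unique.Propositional using (Unique)
import Data.List.Relation.Unary.Unique.Setoid as SetoidUnique
open import Data.Nat.Base using (ℕ; zero; suc; _+_; _*_; _∸_; _^_; _≤_; _<_; z≤n; s≤s; ⌊_/2⌋; ⌈_/2⌉)
open import Data.Nat.DivMod using (_/_; _%_; m≡m%n+[m/n]*n; m%n<n)
open import Data.Nat.Induction using (<-rec)
open import Data.Nat.Logarithm using (⌊log₂_⌋; ⌊log₂⌋-mono-≤; ⌊log₂[2^n]⌋≡n; ⌊log₂⌊n/2⌋⌋≡⌊log₂n⌋∸1)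
open import Data.Nat.Properties using (*-cancelˡ-≡; +-identityʳ; +-mono-<; +-mono-≤; +-suc; 1+n≰n; <-trans; <⇒≱; even≢odd; m^n>0; m∸n+n≡m; m≤m+n; m≤n+m∸n; n<1+n; n≤1+n; suc-injective)
open import Data.Nat.Properties using (≤-antisym; ≤-reflexive; ≤-total; ≤-trans; ≤⇒≯; ≮⇒≥; ≰⇒>; ⌊n/2⌋+⌈n/2⌉≡n; ⌊n/2⌋≤⌈n/2⌉; module ≤-Reasoning)
open import Data.Product.Base using (Σ-syntax; ∃; ∃-syntax; _×_; _,_; proj₁; proj₂)
open import Data.Sum.Base using (_⊎_; inj₁; inj₂; [_,_]′)
open import Function.Base using (_∘_; id)
open import Function.Bundles using (Injection; Bijection; Surjection)
open import Induction.WellFounded using (Acc; acc; WellFounded)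
open import Level using (_⊔_; Lift; lift; lower)
open import Relation.Binary.Bundles using (Setoid)
open import Relation.Binary.Core using (Rel)
open import Relation.Binary.Definitions using (Transitive)
open import Relation.Binary.PropositionalEquality using (_≡_; _≢_; _≗_; refl; cong; subst; _→-setoid_)
import Relation.Binary.PropositionalEquality as ≡
import Relation.Binary.Reasoning.Setoid as SetoidReasoning
open import Relation.Nullary.Decidable.Core using (Dec; yes; no; isYes; toWitness; fromWitness; decidable-stable)
open import Relation.Nullary.Negation.Core using (¬_; contradiction)
open import Relation.Unary using (Pred; _∩_; _∪_; _⊆_)

-- Zermelo's well-ordering theorem.

module WellOrdering
  (em : ∀ {u} → ExcludedMiddle u) (ac : ∀ {u v} → AxiomOfChoice u v)
  {c} (X : Set c)
  where

  -- Boolean-valued subsets make up for the lack of impredicativity: excluded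
  -- middle turns a predicate of any level into one, and 𝒫 stays at level c.
  𝒫 : Set c
  𝒫 = X → Bool

  infix 4 _∈ᵇ_ _⊆ᵇ_

  _∈ᵇ_ : X → 𝒫 → Set
  x ∈ᵇ P = T (P x)

  _⊆ᵇ_ : Rel 𝒫 c
  P ⊆ᵇ Q = ∀ {x} → x ∈ᵇ P → x ∈ᵇ Q

  ｛_｝ : ∀ {p} → Pred X p → 𝒫
  ｛ φ ｝ x = isYes (em {P = φ x})

  extensional : ∀ {P Q} → P ⊆ᵇ Q → Q ⊆ᵇ P → P ≗ Q
  extensional {P} {Q} P⊆Q Q⊆P x with P x | Q x | P⊆Q {x} | Q⊆P {x}
  ... | Bool.true  | Bool.true  | _ | _ = refl
  ... | Bool.false | Bool.false | _ | _ = refl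
  ... | Bool.true  | Bool.false | f | _ = contradiction (f _) id
  ... | Bool.false | Bool.true  | _ | g = contradiction (g _) id

  private
    choice = ac (X →-setoid Bool)
    rep    = proj₁ choice

    Witness : ∀ {P : 𝒫} → Dec (∃[ x ] ¬ x ∈ᵇ P) → Pred X c
    Witness (yes (z , _)) x = x ≡ z
    Witness (no  _)       x = Lift c ⊥

  -- The representative of the extensionality class is what makes the
  -- element missing from P depend only on the extension of P.
  Next : 𝒫 → Pred X c
  Next P = Witness {rep P} em

  next∉ : ∀ P {x} → Next P x → ¬ x ∈ᵇ P
  next∉ P n with em {P = ∃[ x ] ¬ x ∈ᵇ rep P}
  next∉ P refl | yes (z , z∉) = z∉ ∘ subst T (≡.sym (proj₁ (proj₂ choice) P z))

  next-unique : ∀ P {x y} → Next P x → Next P y → x ≡ y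
  next-unique P m n with em {P = ∃[ x ] ¬ x ∈ᵇ rep P}
  next-unique P refl refl | yes _ = refl

  next-ext : ∀ {P Q} → P ⊆ᵇ Q → Q ⊆ᵇ P → ∀ {x} → Next P x → Next Q x
  next-ext {P} {Q} P⊆Q Q⊆P {x} =
    subst (λ R → Witness {R} em x) (proj₂ (proj₂ choice) (extensional {P} {Q} P⊆Q Q⊆P))

  next-exists : ∀ P {x} → ¬ x ∈ᵇ P → ∃ (Next P)
  next-exists P {x} x∉ with em {P = ∃[ x ] ¬ x ∈ᵇ rep P}
  ... | yes (z , _) = z , refl
  ... | no  all     = contradiction (x , x∉ ∘ subst T (proj₁ (proj₂ choice) P x)) all

  _⁺ : 𝒫 → 𝒫
  P ⁺ = ｛ (λ x → x ∈ᵇ P ⊎ Next P x) ｝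

  ⋃ : (𝒫 → Bool) → 𝒫
  ⋃ 𝓕 = ｛ (λ x → ∃[ P ] T (𝓕 P) × x ∈ᵇ P) ｝

  -- Zermelo's construction, in the style of the Bourbaki–Witt theorem.
  data Tower : Pred 𝒫 c where
    step : ∀ {P} → Tower P → Tower (P ⁺)
    join : ∀ 𝓕 → (∀ {P} → T (𝓕 P) → Tower P) → Tower (⋃ 𝓕)

  ⊆⁺ : ∀ P → P ⊆ᵇ P ⁺
  ⊆⁺ P x∈P = fromWitness (inj₁ x∈P)

  next∈⁺ : ∀ P {x} → Next P x → x ∈ᵇ P ⁺
  next∈⁺ P n = fromWitness (inj₂ n)

  ⁺-ext : ∀ {P Q} → P ⊆ᵇ Q → Q ⊆ᵇ P → P ⁺ ⊆ᵇ Q ⁺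
  ⁺-ext {P} {Q} P⊆Q Q⊆P x∈ =
    [ ⊆⁺ Q ∘ P⊆Q , next∈⁺ Q ∘ next-ext {P} {Q} P⊆Q Q⊆P ]′ (toWitness x∈)

  ⊆⋃ : ∀ 𝓕 {P} → T (𝓕 P) → P ⊆ᵇ ⋃ 𝓕
  ⊆⋃ 𝓕 P∈𝓕 x∈P = fromWitness (_ , P∈𝓕 , x∈P)

  ⋃⊆ : ∀ 𝓕 {Q} → (∀ {P} → T (𝓕 P) → P ⊆ᵇ Q) → ⋃ 𝓕 ⊆ᵇ Q
  ⋃⊆ 𝓕 below x∈ with toWitness x∈
  ... | _ , P∈𝓕 , x∈P = below P∈𝓕 x∈P

  -- The extreme points of the Bourbaki-Witt argument, with the strictness of the inclusion of `Q`
  -- in `P` moved into the conclusion as the alternative `P ⊆ᵇ Q`.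
  Extreme : Pred 𝒫 c
  Extreme P = ∀ {Q} → Tower Q → Q ⊆ᵇ P → P ⊆ᵇ Q ⊎ Q ⁺ ⊆ᵇ P

  -- Induction on the tower of `Q`. When `Q ⊆ᵇ P`, extremality either keeps `Q ⁺` inside `P` or
  -- makes the two sets coextensive, and `_⁺` depends only on the extension. A union contains `P ⁺`
  -- as soon as one member does.
  extreme⇒comparable : ∀ {P} → Extreme P → ∀ {Q} → Tower Q → Q ⊆ᵇ P ⊎ P ⁺ ⊆ᵇ Q
  extreme⇒comparable {P} ext (step {Q} tQ) with extreme⇒comparable ext tQ
  ... | inj₂ P⁺⊆Q = inj₂ (⊆⁺ Q ∘ P⁺⊆Q)
  ... | inj₁ Q⊆P with ext tQ Q⊆P
  ...   | inj₁ P⊆Q  = inj₂ (⁺-ext {P} {Q} P⊆Q Q⊆P)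
  ...   | inj₂ Q⁺⊆P = inj₁ Q⁺⊆P
  extreme⇒comparable {P} ext (join 𝓕 t) with em {P = ∃[ Q ] T (𝓕 Q) × P ⁺ ⊆ᵇ Q}
  ... | yes (Q , Q∈𝓕 , P⁺⊆Q) = inj₂ (⊆⋃ 𝓕 Q∈𝓕 ∘ P⁺⊆Q)
  ... | no  none = inj₁ (⋃⊆ 𝓕 {P} λ Q∈𝓕 →
    [ id , (λ P⁺⊆Q → contradiction (_ , Q∈𝓕 , P⁺⊆Q) none) ]′ (extreme⇒comparable ext (t Q∈𝓕)))

  -- Induction on the tower of `P`. If a union is not contained in `Q`, neither is some member of
  -- it, and comparing `Q` with that member leaves only the case that the member contains `Q ⁺`.
  extreme : ∀ {P} → Tower P → Extreme P
  extreme (step {P} tP) {Q} tQ Q⊆P⁺ with extreme⇒comparable (extreme tP) tQ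
  ... | inj₂ P⁺⊆Q = inj₁ P⁺⊆Q
  ... | inj₁ Q⊆P with extreme tP tQ Q⊆P
  ...   | inj₁ P⊆Q  = inj₂ (⁺-ext {Q} {P} Q⊆P P⊆Q)
  ...   | inj₂ Q⁺⊆P = inj₂ (⊆⁺ P ∘ Q⁺⊆P)
  extreme (join 𝓕 t) {Q} tQ Q⊆⋃ with em {P = ∃[ P ] T (𝓕 P) × ¬ P ⊆ᵇ Q}
  ... | no  none = inj₁ (⋃⊆ 𝓕 {Q} λ P∈𝓕 →
    decidable-stable em λ P⊈Q → none (_ , P∈𝓕 , P⊈Q))
  ... | yes (P , P∈𝓕 , P⊈Q) with extreme⇒comparable (extreme (t P∈𝓕)) tQ
  ...   | inj₂ P⁺⊆Q = contradiction (λ {x} → P⁺⊆Q {x} ∘ ⊆⁺ P {x}) P⊈Q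
  ...   | inj₁ Q⊆P with extreme (t P∈𝓕) tQ Q⊆P
  ...     | inj₁ P⊆Q  = contradiction (λ {x} → P⊆Q {x}) P⊈Q
  ...     | inj₂ Q⁺⊆P = inj₂ (⊆⋃ 𝓕 P∈𝓕 ∘ Q⁺⊆P)

  comparable : ∀ {P Q} → Tower P → Tower Q → Q ⊆ᵇ P ⊎ P ⁺ ⊆ᵇ Q
  comparable tP = extreme⇒comparable (extreme tP)

  avoiding : X → 𝒫 → Bool
  avoiding x P = isYes (em {P = Tower P × ¬ x ∈ᵇ P})

  -- The largest set of the tower that misses `x`; it serves as the initial segment of `x`.
  Before : X → 𝒫
  Before x = ⋃ (avoiding x)

  before-tower : ∀ x → Tower (Before x)
  before-tower x = join (avoiding x) (proj₁ ∘ toWitness)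

  x∉before : ∀ x → ¬ x ∈ᵇ Before x
  x∉before x x∈ with toWitness x∈
  ... | P , P∈ , x∈P = proj₂ (toWitness {a? = em {P = Tower P × ¬ x ∈ᵇ P}} P∈) x∈P

  -- If `Before x ⁺` still missed `x`, it would be one of the sets united in `Before x`, although it
  -- has an element outside. So the element added is `x`.
  next-before : ∀ x → Next (Before x) x
  next-before x with next-exists (Before x) (x∉before x)
  ... | z , n with em {P = x ∈ᵇ Before x ⁺}
  ...   | no x∉ = contradiction
    (⊆⋃ (avoiding x) {Before x ⁺} (fromWitness (step (before-tower x) , x∉)) (next∈⁺ (Before x) n))
    (next∉ (Before x) n)
  ...   | yes x∈ = [ (λ x∈B → contradiction x∈B (x∉before x)) , id ]′ (toWitness x∈)

  infix 4 _≺_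

  _≺_ : Rel X _
  y ≺ x = y ∈ᵇ Before x

  -- Initial segments are comparable, and coextensive ones have the same next element.
  ≺-trichotomy : ∀ x y → x ≺ y ⊎ x ≡ y ⊎ y ≺ x
  ≺-trichotomy x y with comparable (before-tower x) (before-tower y) | comparable (before-tower y) (before-tower x)
  ... | inj₂ x⁺⊆y | _         = inj₁ (x⁺⊆y (next∈⁺ (Before x) (next-before x)))
  ... | inj₁ _    | inj₂ y⁺⊆x = inj₂ (inj₂ (y⁺⊆x (next∈⁺ (Before y) (next-before y))))
  ... | inj₁ y⊆x  | inj₁ x⊆y  = inj₂ (inj₁ (next-unique (Before y)
    (next-ext {Before x} {Before y} x⊆y y⊆x (next-before x)) (next-before y)))

  ≺-trans : Transitive _≺_
  ≺-trans {x} {y} {z} x≺y y≺z with comparable (before-tower z) (before-tower y)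
  ... | inj₁ y⊆z  = y⊆z x≺y
  ... | inj₂ z⁺⊆y = contradiction (z⁺⊆y (⊆⁺ (Before z) y≺z)) (x∉before y)

  -- Recursion on the tower: for `x` in `P ⁺`, the segment `Before x` cannot include `P ⁺`, which
  -- has `x` in it, so it lies inside `P`.
  tower-accessible : ∀ {P} → Tower P → ∀ {x} → x ∈ᵇ P → Acc _≺_ x
  tower-accessible (join 𝓕 t) x∈ with toWitness x∈
  ... | _ , P∈𝓕 , x∈P = tower-accessible (t P∈𝓕) x∈P
  tower-accessible (step {P} tP) {x} x∈ = acc λ {y} y≺x →
    [ (λ x⊆P → tower-accessible tP (x⊆P y≺x))
    , (λ P⁺⊆x → contradiction (P⁺⊆x x∈) (x∉before x)) ]′
    (comparable tP (before-tower x))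

  ≺-wellFounded : WellFounded _≺_
  ≺-wellFounded x = tower-accessible (step (before-tower x)) (next∈⁺ (Before x) (next-before x))

-- Pairing, countability and least numbers.

pair : ℕ → ℕ → ℕ
pair zero    n = suc (2 * n)
pair (suc m) n = 2 * pair m n

-- `pair m n` is 2^m (2n + 1): the exponent of 2 gives back `m`, the odd part `n`.
pair-injective : ∀ m {n} m′ {n′} → pair m n ≡ pair m′ n′ → m ≡ m′ × n ≡ n′
pair-injective zero    zero     eq = refl , *-cancelˡ-≡ _ _ 2 (suc-injective eq)
pair-injective zero {n} (suc m′) {n′} eq = contradiction (≡.sym eq) (even≢odd (pair m′ n′) n)
pair-injective (suc m) {n} zero {n′} eq = contradiction eq (even≢odd (pair m n) n′)
pair-injective (suc m) (suc m′) eq with pair-injective m m′ (*-cancelˡ-≡ _ _ 2 eq)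
... | refl , refl = refl , refl

-- The map need not respect `_≈_`, so it may depend on a witness picked by excluded middle;
-- `countableOn⇒countable` repairs this with representatives.
CountableOn : ∀ {c ℓ p} (S : Setoid c ℓ) → Pred (Setoid.Carrier S) p → Set (c ⊔ ℓ ⊔ p)
CountableOn S P = Σ[ f ∈ (Carrier → ℕ) ] (∀ {x y} → P x → P y → f x ≡ f y → x ≈ y)
  where open Setoid S

least : (∀ {u} → ExcludedMiddle u) → ∀ {p} {P : Pred ℕ p} → ∃ P → ∃[ n ] P n × (∀ {m} → P m → n ≤ m)
least em {P = P} (n , pn) = <-rec (λ n → P n → ∃[ n ] P n × (∀ {m} → P m → n ≤ m)) go n pn
  where
  go : ∀ n → (∀ {m} → m < n → P m → ∃[ n ] P n × (∀ {m} → P m → n ≤ m)) → P n →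
       ∃[ n ] P n × (∀ {m} → P m → n ≤ m)
  go n smaller pn with em {P = ∃[ m ] m < n × P m}
  ... | yes (_ , m<n , pm) = smaller m<n pm
  ... | no  none = n , pn , λ pm → ≮⇒≥ (λ m<n → none (_ , m<n , pm))

-- Supports over a well-ordered family in an abelian group.

module Support
  (em : ∀ {u} → ExcludedMiddle u)
  {a ℓ} (𝔸 : AbelianGroup a ℓ)
  {i r} {I : Set i} (ι : I → AbelianGroup.Carrier 𝔸)
  (_≺_ : Rel I r) (≺-wellFounded : WellFounded _≺_) (≺-trans : Transitive _≺_)
  (≺-trichotomy : ∀ x y → x ≺ y ⊎ x ≡ y ⊎ y ≺ x)
  where

  open AbelianGroup 𝔸 renaming (refl to ≈-refl; sym to ≈-sym; trans to ≈-trans)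
  open AbelianGroupProperties 𝔸
  open CommutativeSemigroupProperties commutativeSemigroup using (interchange)
  open Mult monoid using (×-homo-+; ×-assocˡ; ×-congˡ) renaming (_×_ to _·_)
  open SetoidReasoning setoid

  -- Subgroups generated by sets of indices.

  data Span {p} (P : Pred I p) : Pred Carrier (a ⊔ ℓ ⊔ i ⊔ p) where
    gen  : ∀ {x} → P x → Span P (ι x)
    unit : Span P ε
    mul  : ∀ {g h} → Span P g → Span P h → Span P (g ∙ h)
    inv  : ∀ {g} → Span P g → Span P (g ⁻¹)
    resp : ∀ {g h} → g ≈ h → Span P g → Span P h

  mono : ∀ {p q} {P : Pred I p} {Q : Pred I q} → P ⊆ Q → Span P ⊆ Span Q
  mono P⊆Q (gen x)    = gen (P⊆Q x)
  mono P⊆Q unit       = unit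
  mono P⊆Q (mul s t)  = mul (mono P⊆Q s) (mono P⊆Q t)
  mono P⊆Q (inv s)    = inv (mono P⊆Q s)
  mono P⊆Q (resp e s) = resp e (mono P⊆Q s)

  cancelSpan : ∀ {p} {P : Pred I p} {g h} → Span P g → Span P (g ∙ h) → Span P h
  cancelSpan s t = resp (\\-leftDividesʳ _ _) (mul (inv s) t)

  multiple : ∀ {p} {P : Pred I p} {g} n → Span P g → Span P (n · g)
  multiple zero    s = unit
  multiple (suc n) s = mul s (multiple n s)

  span-∪ : ∀ {p q} {P : Pred I p} {Q : Pred I q} {g} → Span (P ∪ Q) g →
           ∃[ h ] ∃[ m ] Span P h × Span Q m × g ≈ h ∙ m
  span-∪ (gen (inj₁ x)) = _ , ε , gen x , unit , ≈-sym (identityʳ _)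
  span-∪ (gen (inj₂ x)) = ε , _ , unit , gen x , ≈-sym (identityˡ _)
  span-∪ unit           = ε , ε , unit , unit , ≈-sym (identityˡ ε)
  span-∪ (mul s t) with span-∪ s | span-∪ t
  ... | _ , _ , h₁ , m₁ , e₁ | _ , _ , h₂ , m₂ , e₂ =
    _ , _ , mul h₁ h₂ , mul m₁ m₂ , ≈-trans (∙-cong e₁ e₂) (interchange _ _ _ _)
  span-∪ (inv s) with span-∪ s
  ... | _ , _ , h , m , e = _ , _ , inv h , inv m , ≈-trans (⁻¹-cong e) (≈-sym (⁻¹-∙-comm _ _))
  span-∪ (resp g≈h s) with span-∪ s
  ... | _ , _ , h , m , e = _ , _ , h , m , ≈-trans (≈-sym g≈h) e

  span-finite : ∀ {p} {P : Pred I p} {g} → Span P g → ∃[ M ] All P M × Span (_∈ M) g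
  span-finite (gen {x} px) = x ∷ [] , px ∷ [] , gen (here refl)
  span-finite unit = [] , [] , unit
  span-finite (mul s t) with span-finite s | span-finite t
  ... | M , pM , s′ | N , pN , t′ =
    M ++ N , All.++⁺ pM pN , mul (mono ∈-++⁺ˡ s′) (mono (∈-++⁺ʳ M) t′)
  span-finite (inv s) with span-finite s
  ... | M , pM , s′ = M , pM , inv s′
  span-finite (resp e s) with span-finite s
  ... | M , pM , s′ = M , pM , resp e s′

  -- The integer coefficient of `ι x` is recorded as a difference `k` - `l` of naturals, with the
  -- negative part moved to the other side.
  span-singleton : ∀ {x g} → Span (_≡ x) g → ∃[ k ] ∃[ l ] g ∙ (l · ι x) ≈ k · ι x
  span-singleton (gen refl) = 1 , 0 , ≈-refl
  span-singleton unit       = 0 , 0 , identityˡ ε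
  span-singleton {x} (mul {g} {h} s t) with span-singleton s | span-singleton t
  ... | k , l , e | k′ , l′ , e′ = k + k′ , l + l′ , (begin
    (g ∙ h) ∙ ((l + l′) · ι x)           ≈⟨ ∙-congˡ (×-homo-+ (ι x) l l′) ⟩
    (g ∙ h) ∙ ((l · ι x) ∙ (l′ · ι x))   ≈⟨ interchange _ _ _ _ ⟩
    (g ∙ (l · ι x)) ∙ (h ∙ (l′ · ι x))   ≈⟨ ∙-cong e e′ ⟩
    (k · ι x) ∙ (k′ · ι x)               ≈⟨ ×-homo-+ (ι x) k k′ ⟨
    (k + k′) · ι x                       ∎)
  span-singleton (inv s) with span-singleton s
  ... | k , l , e = l , k , ≈-trans (∙-congˡ (≈-sym e)) (\\-leftDividesʳ _ _)
  span-singleton (resp e s) with span-singleton s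
  ... | k , l , e′ = k , l , ≈-trans (∙-congʳ (≈-sym e)) e′

  span-[] : ∀ {g} → Span (_∈ []) g → g ≈ ε
  span-[] unit       = ≈-refl
  span-[] (mul s t)  = ≈-trans (∙-cong (span-[] s) (span-[] t)) (identityˡ ε)
  span-[] (inv s)    = ≈-trans (⁻¹-cong (span-[] s)) ε⁻¹≈ε
  span-[] (resp e s) = ≈-trans (≈-sym e) (span-[] s)

  -- `g` = (`k` - `l`) `ι x` + `h`, written without subtraction.
  Decomposition : I → List I → Pred Carrier _
  Decomposition x L g = ∃[ k ] ∃[ l ] ∃[ h ] Span (_∈ L) h × g ∙ (l · ι x) ≈ (k · ι x) ∙ h

  span-∷ : ∀ {x L g} → Span (_∈ (x ∷ L)) g → Decomposition x L g
  span-∷ {x} {L} {g} s with span-∪ (mono (λ { (here p) → inj₁ p ; (there q) → inj₂ q }) s)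
  ... | m , h , sm , sh , e with span-singleton sm
  ... | k , l , e′ = k , l , h , sh , (begin
    g ∙ (l · ι x)          ≈⟨ ∙-cong e (≈-sym (identityʳ _)) ⟩
    (m ∙ h) ∙ ((l · ι x) ∙ ε) ≈⟨ interchange _ _ _ _ ⟩
    (m ∙ (l · ι x)) ∙ (h ∙ ε) ≈⟨ ∙-cong e′ (identityʳ h) ⟩
    (k · ι x) ∙ h          ∎)

  -- Induction on `L`: the coefficient of the head and the remainder in the span of the tail
  -- determine the element, by cancellation.
  span-countable : ∀ L → CountableOn setoid (Span (_∈ L))
  span-countable [] = (λ _ → 0) , λ s t _ → ≈-trans (span-[] s) (≈-sym (span-[] t))
  span-countable (x ∷ L) = (λ g → code g em) , λ {g} {h} → code-injective g h em em
    where
    f = proj₁ (span-countable L)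

    encode : ∀ {g} → Decomposition x L g → ℕ
    encode (k , l , h , _) = pair k (pair l (f h))

    encode-injective : ∀ {g h} (d : Decomposition x L g) (d′ : Decomposition x L h) → encode d ≡ encode d′ → g ≈ h
    encode-injective {g} {h} (k , l , u , su , e) (k′ , l′ , u′ , su′ , e′) eq with pair-injective k k′ eq
    ... | refl , eq₁ with pair-injective l l′ eq₁
    ... | refl , eq₂ = ∙-cancelʳ _ _ _ (begin
      g ∙ (l · ι x)   ≈⟨ e ⟩
      (k · ι x) ∙ u   ≈⟨ ∙-congˡ (proj₂ (span-countable L) su su′ eq₂) ⟩
      (k · ι x) ∙ u′  ≈⟨ e′ ⟨
      h ∙ (l · ι x)   ∎)

    code : ∀ g → Dec (Span (_∈ (x ∷ L)) g) → ℕ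
    code g (no  _) = 0
    code g (yes s) = encode (span-∷ s)

    code-injective : ∀ g h d d′ → Span (_∈ (x ∷ L)) g → Span (_∈ (x ∷ L)) h → code g d ≡ code h d′ → g ≈ h
    code-injective g h (no ¬s) _       s t _ = contradiction s ¬s
    code-injective g h (yes _) (no ¬t) s t _ = contradiction t ¬t
    code-injective g h (yes s) (yes t) _ _ eq = encode-injective (span-∷ s) (span-∷ t) eq

  -- ℤ is Noetherian: the multiples of ι x lying below x are those of a single one of them.
  multiples-below : ∀ x → ∃[ M ] All (_≺ x) M × (∀ k → Span (_≺ x) (k · ι x) → Span (_∈ M) (k · ι x))
  multiples-below x with em {P = ∃[ n ] Span (_≺ x) (suc n · ι x)}
  ... | no none = [] , [] , λ { zero _ → unit ; (suc n) s → contradiction (n , s) none }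
  ... | yes some with least em some
  ... | n , s , n-least with span-finite s
  ... | M , M≺x , s′ = M , M≺x , λ k t → resp (≈-sym (dividing k t)) (multiple (k / suc n) s′)
    where
    dividing : ∀ k → Span (_≺ x) (k · ι x) → k · ι x ≈ (k / suc n) · (suc n · ι x)
    dividing k t = remainder (k % suc n) (m%n<n k (suc n)) (begin
        k · ι x                                             ≈⟨ ×-congˡ (m≡m%n+[m/n]*n k (suc n)) ⟩
        (k % suc n + k / suc n * suc n) · ι x               ≈⟨ ×-homo-+ (ι x) (k % suc n) _ ⟩
        (k % suc n) · ι x ∙ (k / suc n * suc n) · ι x       ≈⟨ ∙-congˡ (×-assocˡ (ι x) (k / suc n) (suc n)) ⟨
        (k % suc n) · ι x ∙ (k / suc n) · (suc n · ι x)     ∎)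
      where
      remainder : ∀ j → j < suc n → k · ι x ≈ j · ι x ∙ (k / suc n) · (suc n · ι x) →
                  k · ι x ≈ (k / suc n) · (suc n · ι x)
      remainder zero    _   e = ≈-trans e (identityˡ _)
      -- A nonzero remainder would give a positive multiple below `x` smaller than `suc n · ι x`.
      remainder (suc j) (s≤s j<n) e = contradiction j<n (≤⇒≯ (n-least
        (cancelSpan (multiple (k / suc n) s) (resp (≈-trans e (comm _ _)) t))))

  -- Passes from natural to integer multiples: according to the sign of the coefficient, either `m`
  -- or its inverse is a natural multiple of `ι x`.
  cyclic-below : ∀ x → ∃[ M ] All (_≺ x) M × (∀ {m} → Span (_≡ x) m → Span (_≺ x) m → Span (_∈ M) m)
  cyclic-below x with multiples-below x
  ... | M , M≺x , below = M , M≺x , λ sm s≺x → cases s≺x (span-singleton sm)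
    where
    difference : ∀ {m k l} → l ≤ k → Span (_≺ x) m → m ∙ (l · ι x) ≈ k · ι x → Span (_∈ M) m
    difference {m} {k} {l} l≤k s e = resp (≈-sym m≈) (below (k ∸ l) (resp m≈ s))
      where
      m≈ : m ≈ (k ∸ l) · ι x
      m≈ = ∙-cancelʳ (l · ι x) _ _ (begin
        m ∙ (l · ι x)                     ≈⟨ e ⟩
        k · ι x                           ≈⟨ ×-congˡ (m∸n+n≡m l≤k) ⟨
        (k ∸ l + l) · ι x                 ≈⟨ ×-homo-+ (ι x) (k ∸ l) l ⟩
        ((k ∸ l) · ι x) ∙ (l · ι x)       ∎)

    cases : ∀ {m} → Span (_≺ x) m → ∃[ k ] ∃[ l ] m ∙ (l · ι x) ≈ k · ι x → Span (_∈ M) m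
    cases {m} s (k , l , e) with ≤-total l k
    ... | inj₁ l≤k = difference l≤k s e
    ... | inj₂ k≤l = resp (⁻¹-involutive m) (inv (difference k≤l (inv s)
      (≈-trans (∙-congˡ (≈-sym e)) (\\-leftDividesʳ _ _))))

  -- Initial segments and closed sets.

  _≼_ : Rel I (i ⊔ r)
  x ≼ y = x ≺ y ⊎ x ≡ y

  ≺-≼-trans : ∀ {x y z} → x ≺ y → y ≼ z → x ≺ z
  ≺-≼-trans x≺y (inj₁ y≺z)  = ≺-trans x≺y y≺z
  ≺-≼-trans x≺y (inj₂ refl) = x≺y

  ≼-≺-trans : ∀ {x y z} → x ≼ y → y ≺ z → x ≺ z
  ≼-≺-trans (inj₁ x≺y)  y≺z = ≺-trans x≺y y≺z
  ≼-≺-trans (inj₂ refl) y≺z = y≺z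

  ≼-trans : ∀ {x y z} → x ≼ y → y ≼ z → x ≼ z
  ≼-trans (inj₁ x≺y)  y≼z = inj₁ (≺-≼-trans x≺y y≼z)
  ≼-trans (inj₂ refl) y≼z = y≼z

  ≺⊎≽ : ∀ x y → x ≺ y ⊎ y ≼ x
  ≺⊎≽ x y with ≺-trichotomy x y
  ... | inj₁ x≺y         = inj₁ x≺y
  ... | inj₂ (inj₁ refl) = inj₂ (inj₂ refl)
  ... | inj₂ (inj₂ y≺x)  = inj₂ (inj₁ y≺x)

  UpTo : ∀ {p} → Pred I p → I → Pred I _
  UpTo P z = P ∩ (_≼ z)

  Below : ∀ {p} → Pred I p → I → Pred I _
  Below P z = P ∩ (_≺ z)

  UpTo-mono : ∀ {p} {P : Pred I p} {y z} → y ≼ z → Span (UpTo P y) ⊆ Span (UpTo P z)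
  UpTo-mono y≼z = mono λ (px , x≼y) → px , ≼-trans x≼y y≼z

  -- A derivation uses finitely many generators, so one of them is greatest; a derivation using none
  -- yields `ε`.
  greatest : ∀ {p} {P : Pred I p} {g} → Span P g → (g ≈ ε) ⊎ (∃[ z ] P z × Span (UpTo P z) g)
  greatest (gen px) = inj₂ (_ , px , gen (px , inj₂ refl))
  greatest unit     = inj₁ ≈-refl
  greatest (mul s t) with greatest s | greatest t
  ... | inj₁ e            | inj₁ e′            = inj₁ (≈-trans (∙-cong e e′) (identityˡ ε))
  ... | inj₁ e            | inj₂ (z , pz , t′) =
    inj₂ (z , pz , resp (≈-trans (≈-sym (identityˡ _)) (∙-congʳ (≈-sym e))) t′)
  ... | inj₂ (z , pz , s′) | inj₁ e            =
    inj₂ (z , pz , resp (≈-trans (≈-sym (identityʳ _)) (∙-congˡ (≈-sym e))) s′)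
  ... | inj₂ (y , py , s′) | inj₂ (z , pz , t′) with ≺⊎≽ y z
  ...   | inj₁ y≺z = inj₂ (z , pz , mul (UpTo-mono (inj₁ y≺z) s′) t′)
  ...   | inj₂ z≼y = inj₂ (y , py , mul s′ (UpTo-mono z≼y t′))
  greatest (inv s) with greatest s
  ... | inj₁ e             = inj₁ (≈-trans (⁻¹-cong e) ε⁻¹≈ε)
  ... | inj₂ (z , pz , s′) = inj₂ (z , pz , inv s′)
  greatest (resp e s) with greatest s
  ... | inj₁ e′            = inj₁ (≈-trans (≈-sym e) e′)
  ... | inj₂ (z , pz , s′) = inj₂ (z , pz , resp e s′)

  greatest-below : ∀ {p} {P : Pred I p} {z g} → Span (Below P z) g →
                   (g ≈ ε) ⊎ (∃[ y ] y ≺ z × Span (UpTo P y) g)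
  greatest-below s with greatest s
  ... | inj₁ e                   = inj₁ e
  ... | inj₂ (y , (_ , y≺z) , t) = inj₂ (y , y≺z , mono (λ ((px , _) , x≼y) → px , x≼y) t)

  split : ∀ {p} {P : Pred I p} {z g} → Span (UpTo P z) g →
          ∃[ h ] ∃[ m ] Span (Below P z) h × Span (P ∩ (_≡ z)) m × g ≈ h ∙ m
  split s = span-∪ (mono (λ { (px , inj₁ x≺z) → inj₁ (px , x≺z) ; (px , inj₂ x≡z) → inj₂ (px , x≡z) }) s)

  -- Demanding Span P ∩ Span (_≺ x) ⊆ Span (Below P x) of the multiples of ι x
  -- only keeps closedness stable under unions; restrict recovers the rest.
  Closed : ∀ {p} → Pred I p → Set _
  Closed P = ∀ {x m} → Span (P ∩ (_≡ x)) m → Span (_≺ x) m → Span (Below P x) m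

  -- Descent on a bound `z` of the generators used. If `x ≼ z`, write `g` as `h ∙ m` with `m` a
  -- multiple of `ι z`. Both `g` and `h` lie in the span of the predecessors of `z`, hence so does
  -- `m`; closedness rewrites `m` over `Below P z`, which lowers the bound.
  restrict : ∀ {p} {P : Pred I p} → Closed P → ∀ {x g} → Span P g → Span (_≺ x) g → Span (Below P x) g
  restrict {P = P} cl {x} {g} s s≺x with greatest s
  ... | inj₁ e = resp (≈-sym e) unit
  ... | inj₂ (z , _ , t) = go z (≺-wellFounded z) t
    where
    go : ∀ z → Acc _≺_ z → Span (UpTo P z) g → Span (Below P x) g
    go z (acc rs) s with ≺⊎≽ z x
    ... | inj₁ z≺x = mono (λ (py , y≼z) → py , ≼-≺-trans y≼z z≺x) s
    ... | inj₂ x≼z with split s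
    ...   | h , m , sh , sm , e with greatest-below
              (resp (≈-sym e) (mul sh (cl sm (cancelSpan (mono proj₂ sh)
                (resp e (mono (λ y≺x → ≺-≼-trans y≺x x≼z) s≺x))))))
    ...     | inj₁ e′ = resp (≈-sym e′) unit
    ...     | inj₂ (y , y≺z , s′) = go y (rs y≺z) s′

  -- Descent on a common bound `z` of both representations. If `g` lies in the span of the
  -- predecessors of `z`, `restrict` lowers both. Otherwise both must involve `z`, so `z` lies in
  -- `P` and in `Q`, and only the parts below `z` remain to be reconciled.
  span-∩ : ∀ {p q} {P : Pred I p} {Q : Pred I q} → Closed P → Closed Q →
           ∀ {g} → Span P g → Span Q g → Span (P ∩ Q) g
  span-∩ {P = P} {Q} clP clQ s t with greatest s | greatest t
  ... | inj₁ e | _ = resp (≈-sym e) unit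
  ... | _ | inj₁ e = resp (≈-sym e) unit
  ... | inj₂ (y , _ , s′) | inj₂ (z , _ , t′) = both y z s′ t′
    where
    upto : ∀ z → Acc _≺_ z → ∀ {g} → Span (UpTo P z) g → Span (UpTo Q z) g → Span (P ∩ Q) g
    below : ∀ z → Acc _≺_ z → ∀ {g} → Span (Below P z) g → Span (Below Q z) g → Span (P ∩ Q) g

    below z (acc rs) s t with greatest-below s | greatest-below t
    ... | inj₁ e | _ = resp (≈-sym e) unit
    ... | _ | inj₁ e = resp (≈-sym e) unit
    ... | inj₂ (x , x≺z , s′) | inj₂ (y , y≺z , t′) with ≺⊎≽ x y
    ...   | inj₁ x≺y = upto y (rs y≺z) (UpTo-mono (inj₁ x≺y) s′) t′
    ...   | inj₂ y≼x = upto x (rs x≺z) s′ (UpTo-mono y≼x t′)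

    upto z ac {g} s t with em {P = Span (_≺ z) g}
    ... | yes g≺z = below z ac (restrict clP (mono proj₁ s) g≺z) (restrict clQ (mono proj₁ t) g≺z)
    ... | no  g≮z with split s | split t
    ... | h , m , sh , sm , e | h′ , m′ , sh′ , sm′ , e′ with em {P = P z} | em {P = Q z}
    ... | no z∉P | _ = contradiction (resp (≈-sym e)
      (mul (mono proj₂ sh) (mono (λ { (pz , refl) → contradiction pz z∉P }) sm))) g≮z
    ... | _ | no z∉Q = contradiction (resp (≈-sym e′)
      (mul (mono proj₂ sh′) (mono (λ { (qz , refl) → contradiction qz z∉Q }) sm′))) g≮z
    ... | yes z∈P | yes z∈Q = resp (≈-sym e′)
      (mul (below z ac sh″ sh′) (mono (λ { (_ , refl) → z∈P , z∈Q }) sm′))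
      where
      -- The two coefficients of `z` may differ. Their difference `d` equals `h′` - `h`, so it lies
      -- below `z`, and closedness of `P` spans it by `Below P z`. Hence `h′` lies in both spans
      -- below `z`, and the descent applies to `h′`.
      d = m ∙ m′ ⁻¹

      h∙d≈h′ : h ∙ d ≈ h′
      h∙d≈h′ = ∙-cancelʳ m′ _ _ (begin
        (h ∙ (m ∙ m′ ⁻¹)) ∙ m′  ≈⟨ ∙-congʳ (assoc h m (m′ ⁻¹)) ⟨
        ((h ∙ m) ∙ m′ ⁻¹) ∙ m′  ≈⟨ //-rightDividesˡ m′ (h ∙ m) ⟩
        h ∙ m                   ≈⟨ e ⟨
        g                       ≈⟨ e′ ⟩
        h′ ∙ m′                 ∎)

      sd : Span (P ∩ (_≡ z)) d
      sd = mul sm (inv (mono (λ { (_ , refl) → z∈P , refl }) sm′))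

      sh″ : Span (Below P z) h′
      sh″ = resp h∙d≈h′ (mul sh (clP sd
        (cancelSpan (mono proj₂ sh) (resp (≈-sym h∙d≈h′) (mono proj₂ sh′)))))

    both : ∀ y z {g} → Span (UpTo P y) g → Span (UpTo Q z) g → Span (P ∩ Q) g
    both y z s t with ≺⊎≽ y z
    ... | inj₁ y≺z = upto z (≺-wellFounded z) (UpTo-mono (inj₁ y≺z) s) t
    ... | inj₂ z≼y = upto y (≺-wellFounded y) s (UpTo-mono z≼y t)

  Below-closed : ∀ {p} {P : Pred I p} → Closed P → ∀ z → Closed (Below P z)
  Below-closed cl z {x} s s≺x with em {P = x ≺ z}
  ... | yes x≺z = mono (λ (py , y≺x) → (py , ≺-trans y≺x x≺z) , y≺x) (cl (mono (λ ((px , _) , e) → px , e) s) s≺x)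
  ... | no  x≮z = mono (λ { ((_ , x≺z) , refl) → contradiction x≺z x≮z }) s

  -- Closedness of `P` and of `Q` gives two representations below `x`; `span-∩` on the initial
  -- segments merges them.
  ∩-closed : ∀ {p q} {P : Pred I p} {Q : Pred I q} → Closed P → Closed Q → Closed (P ∩ Q)
  ∩-closed clP clQ {x} s s≺x = mono (λ ((px , x≺z) , (qx , _)) → (px , qx) , x≺z)
    (span-∩ (Below-closed clP x) (Below-closed clQ x)
      (clP (mono (λ ((px , _) , e) → px , e) s) s≺x)
      (clQ (mono (λ ((_ , qx) , e) → qx , e) s) s≺x))

  -- The condition concerns multiples of one `ι x` at a time, so the closedness of whichever set
  -- contains `x` suffices.
  ∪-closed : ∀ {p q} {P : Pred I p} {Q : Pred I q} → Closed P → Closed Q → Closed (P ∪ Q)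
  ∪-closed {P = P} clP clQ {x} s s≺x with em {P = P x}
  ... | yes px = mono (λ (py , y≺x) → inj₁ py , y≺x) (clP (mono (λ { (_ , refl) → px , refl }) s) s≺x)
  ... | no ¬px = mono (λ (qy , y≺x) → inj₂ qy , y≺x)
    (clQ (mono (λ { (inj₁ px , refl) → contradiction px ¬px ; (inj₂ qx , refl) → qx , refl }) s) s≺x)

  Closed-resp : ∀ {p q} {P : Pred I p} {Q : Pred I q} → P ⊆ Q → Q ⊆ P → Closed P → Closed Q
  Closed-resp P⊆Q Q⊆P cl s s≺x =
    mono (λ (py , y≺x) → P⊆Q py , y≺x) (cl (mono (λ (qy , e) → Q⊆P qy , e) s) s≺x)

  ++-closed : ∀ {L M} → Closed (_∈ L) → Closed (_∈ M) → Closed (_∈ (L ++ M))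
  ++-closed {L} clL clM = Closed-resp [ ∈-++⁺ˡ , ∈-++⁺ʳ L ]′ (∈-++⁻ L) (∪-closed clL clM)

  -- Well-founded recursion closes off the predecessors `M` supplied by `cyclic-below`. After adding
  -- `x`, the condition at `x` is what `M` was chosen for, and at other indices it is inherited from
  -- `L`.
  finite-closed : ∀ x → ∃[ L ] x ∈ L × Closed (_∈ L)
  finite-closed x = go x (≺-wellFounded x)
    where
    go : ∀ x → Acc _≺_ x → ∃[ L ] x ∈ L × Closed (_∈ L)
    go x (acc rs) with cyclic-below x
    ... | M , M≺x , below with cover M M≺x
      where
      cover : ∀ M → All (_≺ x) M → ∃[ L ] (_∈ M) ⊆ (_∈ L) × Closed (_∈ L)
      cover []      []          = [] , (λ ()) , λ s _ → mono (λ ()) s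
      cover (y ∷ M) (y≺x ∷ M≺x) with go y (rs y≺x) | cover M M≺x
      ... | L , y∈L , clL | N , M⊆N , clN =
        L ++ N , (λ { (here refl) → ∈-++⁺ˡ y∈L ; (there z∈M) → ∈-++⁺ʳ L (M⊆N z∈M) }) , ++-closed clL clN
    ... | L , M⊆L , clL = x ∷ L , here refl , x∷L-closed
      where
      x∷L-closed : Closed (_∈ (x ∷ L))
      x∷L-closed {z} s s≺z with em {P = z ≡ x}
      ... | yes refl = mono (λ y∈M → there (M⊆L y∈M) , All.lookup M≺x y∈M) (below (mono proj₂ s) s≺z)
      ... | no  z≢x  = mono (λ (y∈L , y≺z) → there y∈L , y≺z)
        (clL (mono (λ { (here z≡x , refl) → contradiction z≡x z≢x ; (there z∈L , refl) → z∈L , refl }) s) s≺z)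

  -- Least closed supports.

  record Supports (x : I) (L : List I) : Set (a ⊔ ℓ ⊔ i ⊔ r) where
    constructor supports
    field
      closed : Closed (_∈ L)
      spans  : Span (_∈ L) (ι x)

  open Supports

  -- Minimising the length of the list also rules out repetitions, so this length is the cardinality
  -- of the support.
  minimal-support : ∀ x → ∃[ n ] (∃[ L ] Supports x L × n ≡ length L) ×
                    (∀ {m} → ∃[ L ] Supports x L × m ≡ length L → n ≤ m)
  minimal-support x with finite-closed x
  ... | L , x∈L , cl = least em (length L , L , supports cl (gen x∈L) , refl)

  supp : I → List I
  supp x = proj₁ (proj₁ (proj₂ (minimal-support x)))

  supp-supports : ∀ x → Supports x (supp x)
  supp-supports x = proj₁ (proj₂ (proj₁ (proj₂ (minimal-support x))))

  supp-shortest : ∀ x {L} → Supports x L → length (supp x) ≤ length L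
  supp-shortest x sL with minimal-support x
  ... | _ , (_ , _ , refl) , shortest = shortest (_ , sL , refl)

  -- Least length forces least inclusion: the intersection with `L` is again closed and spans `ι x`,
  -- so an index outside `L` would make it a shorter support.
  supp-least : ∀ x {L} → Supports x L → (_∈ supp x) ⊆ (_∈ L)
  supp-least x {L} sL {u} u∈ = decidable-stable em λ u∉L →
    contradiction (filter-notAll ∈L? (supp x) (lose u∈ u∉L)) (≤⇒≯ (supp-shortest x (supports
      (Closed-resp to from (∩-closed (closed sL) (closed sx)))
      (mono to (span-∩ (closed sL) (closed sx) (spans sL) (spans sx))))))
    where
    sx = supp-supports x

    ∈L? : ∀ y → Dec (y ∈ L)
    ∈L? y = em

    to : (_∈ L) ∩ (_∈ supp x) ⊆ (_∈ filter ∈L? (supp x))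
    to (y∈L , y∈) = ∈-filter⁺ ∈L? y∈ y∈L

    from : (_∈ filter ∈L? (supp x)) ⊆ (_∈ L) ∩ (_∈ supp x)
    from y∈ with ∈-filter⁻ ∈L? y∈
    ... | y∈s , y∈L = y∈L , y∈s

  supp-++ : ∀ x {y z} → Span (_∈ (supp y ++ supp z)) (ι x) → Supports x (supp y ++ supp z)
  supp-++ x s = supports (++-closed (closed (supp-supports _)) (closed (supp-supports _))) s

  supp-cong : ∀ {x y} → ι x ≈ ι y → Supports x (supp y)
  supp-cong {x} {y} e = supports (closed (supp-supports y)) (resp (≈-sym e) (spans (supp-supports y)))

  supp-mul : ∀ {x y z} → ι z ≈ ι x ∙ ι y → Supports z (supp x ++ supp y)
  supp-mul {x} {y} {z} e = supp-++ z (resp (≈-sym e)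
    (mul (mono ∈-++⁺ˡ (spans (supp-supports x))) (mono (∈-++⁺ʳ (supp x)) (spans (supp-supports y)))))

  -- `ι y` is the difference of `ι z` and `ι x`. With `supp-least`, no index of `y` outside the
  -- support of `x` is lost in the sum.
  supp-divide : ∀ {x y z} → ι z ≈ ι x ∙ ι y → Supports y (supp z ++ supp x)
  supp-divide {x} {y} {z} e = supp-++ y (cancelSpan (mono (∈-++⁺ʳ (supp z)) (spans (supp-supports x)))
    (resp e (mono ∈-++⁺ˡ (spans (supp-supports z)))))

-- The group of differences.

module GroupOfDifferences
  {c ℓ} (G : CommutativeSemigroup c ℓ)
  (cancel : Cancellative (CommutativeSemigroup._≈_ G) (CommutativeSemigroup._∙_ G))
  (e : CommutativeSemigroup.Carrier G)
  where

  open CommutativeSemigroup G renaming (refl to ≈-refl)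
  open CommutativeSemigroupProperties G
  open SetoidReasoning setoid

  _~_ : Rel (Carrier × Carrier) ℓ
  (a , b) ~ (a′ , b′) = a ∙ b′ ≈ a′ ∙ b

  ~-trans : ∀ {p q r} → p ~ q → q ~ r → p ~ r
  ~-trans {a , b} {a′ , b′} {a″ , b″} p~q q~r = proj₂ cancel b′ _ _ (begin
    (a ∙ b″) ∙ b′  ≈⟨ xy∙z≈xz∙y a b″ b′ ⟩
    (a ∙ b′) ∙ b″  ≈⟨ ∙-congʳ p~q ⟩
    (a′ ∙ b) ∙ b″  ≈⟨ xy∙z≈xz∙y a′ b b″ ⟩
    (a′ ∙ b″) ∙ b  ≈⟨ ∙-congʳ q~r ⟩
    (a″ ∙ b′) ∙ b  ≈⟨ xy∙z≈xz∙y a″ b′ b ⟩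
    (a″ ∙ b) ∙ b′  ∎)

  group : AbelianGroup c ℓ
  group = record
    { Carrier = Carrier × Carrier
    ; _≈_     = _~_
    ; _∙_     = λ (a , b) (a′ , b′) → a ∙ a′ , b ∙ b′
    ; ε       = e , e
    ; _⁻¹     = λ (a , b) → b , a
    ; isAbelianGroup = record
      { isGroup = record
        { isMonoid = record
          { isSemigroup = record
            { isMagma = record
              { isEquivalence = record
                { refl  = ≈-refl
                ; sym   = sym
                ; trans = λ {p} {q} {r} → ~-trans {p} {q} {r}
                }
              ; ∙-cong = λ p~q r~s → trans (interchange _ _ _ _) (trans (∙-cong p~q r~s) (interchange _ _ _ _))
              }
            ; assoc = λ _ _ _ → ∙-cong (assoc _ _ _) (sym (assoc _ _ _))
            }
          ; identity = (λ (a , b) → xy∙z≈y∙xz e a b) , (λ (a , b) → xy∙z≈x∙zy a e b)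
          }
        ; inverse = (λ (a , b) → trans (comm _ e) (∙-congˡ (comm b a)))
                  , (λ (a , b) → trans (comm _ e) (∙-congˡ (comm a b)))
        ; ⁻¹-cong = λ {(a , b)} {(a′ , b′)} p~q → trans (comm b a′) (trans (sym p~q) (comm a b′))
        }
      ; comm = λ (a , b) (a′ , b′) → ∙-cong (comm a a′) (comm b′ b)
      }
    }

  open AbelianGroup group using () renaming (_≈_ to _≈ᴳ_; _∙_ to _∙ᴳ_)

  -- x as the difference 2x − x, there being no neutral element to subtract.
  ι : Carrier → Carrier × Carrier
  ι x = x ∙ x , x

  ι-cong : ∀ {x y} → x ≈ y → ι x ≈ᴳ ι y
  ι-cong x≈y = ∙-cong (∙-cong x≈y x≈y) (sym x≈y)

  ι-homo : ∀ x y → ι (x ∙ y) ≈ᴳ ι x ∙ᴳ ι y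
  ι-homo x y = ∙-congʳ (interchange x y x y)

  ι-injective : ∀ {x y} → ι x ≈ᴳ ι y → x ≈ y
  ι-injective {x} {y} eq = proj₂ cancel (x ∙ y) _ _ (begin
    x ∙ (x ∙ y)  ≈⟨ assoc x x y ⟨
    (x ∙ x) ∙ y  ≈⟨ eq ⟩
    (y ∙ y) ∙ x  ≈⟨ assoc y y x ⟩
    y ∙ (y ∙ x)  ≈⟨ ∙-congˡ (comm y x) ⟩
    y ∙ (x ∙ y)  ∎)

-- Lengths of lists and countable unions.

module Counting (em : ∀ {u} → ExcludedMiddle u) where

  unique⇒length≤ : ∀ {i} {I : Set i} {L M : List I} → Unique L → (_∈ L) ⊆ (_∈ M) → length L ≤ length M
  unique⇒length≤ {L = []}    _ _ = z≤n
  unique⇒length≤ {L = x ∷ L} {M} (x∉L ∷ uL) L⊆M = ≤-trans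
    (s≤s (unique⇒length≤ uL λ y∈L → ∈-filter⁺ ≢x? (L⊆M (there y∈L)) (All.lookup x∉L y∈L ∘ ≡.sym)))
    (filter-notAll ≢x? M (lose (L⊆M (here refl)) (λ x≢x → x≢x refl)))
    where
    ≢x? : ∀ y → Dec (y ≢ x)
    ≢x? y = em

  module _ {c ℓ} (S : Setoid c ℓ) where
    open Setoid S using (Carrier; _≈_)

    countable-⊆ : ∀ {p q} {P : Pred Carrier p} {Q : Pred Carrier q} → P ⊆ Q → CountableOn S Q → CountableOn S P
    countable-⊆ P⊆Q (f , inj) = f , λ px py → inj (P⊆Q px) (P⊆Q py)

    -- Excluded middle fixes one index for each `x`; the code pairs it with the code of `x` in that
    -- piece.
    countable-⋃ : ∀ {p} {P : ℕ → Pred Carrier p} → (∀ n → CountableOn S (P n)) →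
                  CountableOn S (λ x → ∃[ n ] P n x)
    countable-⋃ {P = P} count = (λ x → code x em) , λ {x} {y} px py → code-injective x y em em px py
      where
      code : ∀ x → Dec (∃[ n ] P n x) → ℕ
      code x (yes (n , _)) = pair n (proj₁ (count n) x)
      code x (no  _)       = 0

      code-injective : ∀ x y d d′ → ∃[ n ] P n x → ∃[ n ] P n y → code x d ≡ code y d′ → x ≈ y
      code-injective x y (no ¬px) _ px _ _ = contradiction px ¬px
      code-injective x y (yes _) (no ¬py) _ py _ = contradiction py ¬py
      code-injective x y (yes (m , px)) (yes (n , py)) _ _ eq with pair-injective m n eq
      ... | refl , eq′ = proj₂ (count m) px py eq′

    countable-∪ : ∀ {p q} {P : Pred Carrier p} {Q : Pred Carrier q} →
                  CountableOn S P → CountableOn S Q → CountableOn S (P ∪ Q)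
    countable-∪ {p} {q} {P} {Q} cP cQ = countable-⊆ index (countable-⋃ {P = family} count)
      where
      family : ℕ → Pred Carrier (p ⊔ q)
      family zero    x = Lift q (P x)
      family (suc _) x = Lift p (Q x)

      count : ∀ n → CountableOn S (family n)
      count zero    = countable-⊆ lower cP
      count (suc _) = countable-⊆ lower cQ

      index : P ∪ Q ⊆ λ x → ∃[ n ] family n x
      index = [ (λ px → 0 , lift px) , (λ qx → 1 , lift qx) ]′

    countable-list : ∀ {i p} {I : Set i} {P : I → Pred Carrier p} L → (∀ {u} → u ∈ L → CountableOn S (P u)) →
                     CountableOn S (λ x → ∃[ u ] u ∈ L × P u x)
    countable-list []      count = (λ _ → 0) , λ { (_ , () , _) }
    countable-list (u ∷ L) count = countable-⊆
      (λ { (_ , here refl , pu) → inj₁ pu ; (_ , there v∈L , pv) → inj₂ (_ , v∈L , pv) })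
      (countable-∪ (count (here refl)) (countable-list L (count ∘ there)))

    uncountable-inhabited : ∀ {p} {P : Pred Carrier p} → ¬ CountableOn S P → ∃ P
    uncountable-inhabited unc = decidable-stable em λ none →
      unc ((λ _ → 0) , λ px → contradiction (_ , px) none)

-- Finite supports in a cancellative commutative semigroup.

record FiniteSupport {c ℓ i} (G : CommutativeSemigroup c ℓ) (I : Set i) : Set (c ⊔ ℓ ⊔ i) where
  open CommutativeSemigroup G
  field
    supp             : Carrier → List I
    supp-cong        : ∀ {x y} → x ≈ y → (_∈ supp x) ⊆ (_∈ supp y)
    supp-length-cong : ∀ {x y} → x ≈ y → length (supp x) ≡ length (supp y)
    supp-length-∙    : ∀ x y → length (supp (x ∙ y)) ≤ length (supp x) + length (supp y)
    supp-∙ˡ          : ∀ x y {u} → u ∈ supp x → u ∉ supp y → u ∈ supp (x ∙ y)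
    supp-∙ʳ          : ∀ x y {u} → u ∈ supp y → u ∉ supp x → u ∈ supp (x ∙ y)
    supp-countable   : ∀ L → CountableOn setoid (λ x → (_∈ supp x) ⊆ (_∈ L))

finiteSupport : (∀ {u} → ExcludedMiddle u) → (∀ {u v} → AxiomOfChoice u v) →
                ∀ {c ℓ} (G : CommutativeSemigroup c ℓ) → let open CommutativeSemigroup G in
                Cancellative _≈_ _∙_ → FiniteSupport G Carrier
finiteSupport em ac G cancel with em {P = CommutativeSemigroup.Carrier G}
-- The neutral element of the group of differences is built from an element of `G`, so the empty
-- semigroup is treated apart.
... | no empty = record
  { supp             = λ x → contradiction x empty
  ; supp-cong        = λ {x} → contradiction x empty
  ; supp-length-cong = λ {x} → contradiction x empty
  ; supp-length-∙    = λ x → contradiction x empty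
  ; supp-∙ˡ          = λ x → contradiction x empty
  ; supp-∙ʳ          = λ x → contradiction x empty
  ; supp-countable   = λ _ → (λ _ → 0) , λ {x} → contradiction x empty
  }
... | yes e = record
  { supp             = supp
  ; supp-cong        = λ x≈y → supp-least _ (supp-cong (ι-cong x≈y))
  ; supp-length-cong = λ x≈y → ≤-antisym (supp-shortest _ (supp-cong (ι-cong x≈y)))
                                         (supp-shortest _ (supp-cong (ι-cong (sym x≈y))))
  ; supp-length-∙    = λ x y → ≤-trans (supp-shortest _ (supp-mul (ι-homo x y)))
                                       (≤-reflexive (length-++ (supp x)))
  ; supp-∙ˡ          = λ x y u∈x u∉y → outside u∉y (∈-++⁻ (supp (x ∙ y))
                         (supp-least x (supp-divide {y} {x} {x ∙ y}
                           (𝔸.trans {ι (x ∙ y)} {ι x 𝔸.∙ ι y} {ι y 𝔸.∙ ι x} (ι-homo x y) (𝔸.comm (ι x) (ι y)))) u∈x))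
  ; supp-∙ʳ          = λ x y u∈y u∉x → outside u∉x (∈-++⁻ (supp (x ∙ y))
                         (supp-least y (supp-divide (ι-homo x y)) u∈y))
  -- A support inside `L` puts `ι x` in the span of `L`, which is countable, and `ι` is injective.
  ; supp-countable   = λ L → proj₁ (span-countable L) ∘ ι , λ {x} {y} x⊆L y⊆L eq →
                         ι-injective (proj₂ (span-countable L)
                           (mono x⊆L (Supports.spans (supp-supports x)))
                           (mono y⊆L (Supports.spans (supp-supports y))) eq)
  }
  where
  open CommutativeSemigroup G
  open WellOrdering em ac Carrier using (_≺_; ≺-wellFounded; ≺-trans; ≺-trichotomy)
  open GroupOfDifferences G cancel e
  module 𝔸 = AbelianGroup group
  open Support em group ι _≺_ ≺-wellFounded ≺-trans ≺-trichotomy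

  outside : ∀ {a b} {A : Set a} {B : Set b} → ¬ B → A ⊎ B → A
  outside ¬b = [ id , (λ b → contradiction b ¬b) ]′

-- Parity and dyadic intervals.

parity : ℕ → Fin 2
parity zero    = zero
parity (suc n) = opposite (parity n)

-- Consecutive numbers differ in parity; this supplies an exponent whose dyadic interval has the
-- colour other than `i`.
parity-misses : ∀ i n → parity n ≢ i ⊎ parity (suc n) ≢ i
parity-misses i n with parity n
parity-misses zero       n | zero     = inj₂ λ ()
parity-misses zero       n | suc zero = inj₁ λ ()
parity-misses (suc zero) n | zero     = inj₁ λ ()
parity-misses (suc zero) n | suc zero = inj₂ λ ()

-- Induction by halving, which lowers the logarithm by one: if ⌊n/2⌋ reached 2^(m+1), then n = ⌊n/2⌋
-- + ⌈n/2⌉ would reach 2^(m+2).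
⌊log₂⌋-upper : ∀ m {n} → n < 2 ^ suc m → ⌊log₂ n ⌋ ≤ m
⌊log₂⌋-upper zero    {0} _ = z≤n
⌊log₂⌋-upper zero    {1} _ = z≤n
⌊log₂⌋-upper zero    {suc (suc n)} (s≤s (s≤s ()))
⌊log₂⌋-upper (suc m) {n} n< = ≤-trans (m≤n+m∸n _ 1) (s≤s (subst (_≤ m) (⌊log₂⌊n/2⌋⌋≡⌊log₂n⌋∸1 n)
  (⌊log₂⌋-upper m (≰⇒> λ 2^≤ → <⇒≱ n< (begin
    2 ^ suc (suc m)          ≡⟨ cong (2 ^ suc m +_) (+-identityʳ _) ⟩
    2 ^ suc m + 2 ^ suc m    ≤⟨ +-mono-≤ 2^≤ (≤-trans 2^≤ (⌊n/2⌋≤⌈n/2⌉ n)) ⟩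
    ⌊ n /2⌋ + ⌈ n /2⌉        ≡⟨ ⌊n/2⌋+⌈n/2⌉≡n n ⟩
    n                        ∎)))))
  where
  open ≤-Reasoning

⌊log₂⌋-unique : ∀ m {n} → 2 ^ m ≤ n → n < 2 ^ suc m → ⌊log₂ n ⌋ ≡ m
⌊log₂⌋-unique m lo hi = ≤-antisym (⌊log₂⌋-upper m hi)
  (≤-trans (≤-reflexive (≡.sym (⌊log₂[2^n]⌋≡n m))) (⌊log₂⌋-mono-≤ lo))

n<2^n : ∀ n → n < 2 ^ n
n<2^n zero    = s≤s z≤n
n<2^n (suc n) = +-mono-≤ (m^n>0 2 n) (≤-trans (n<2^n n) (m≤m+n _ 0))

-- The colouring and its monochromatic sets.

module Colouring
  (em : ∀ {u} → ExcludedMiddle u)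
  {c ℓ i} (G : CommutativeSemigroup c ℓ) {I : Set i} (support : FiniteSupport G I)
  where

  open CommutativeSemigroup G renaming (refl to ≈-refl; sym to ≈-sym)
  open FiniteSupport support
  open Counting em

  ∥_∥ : Carrier → ℕ
  ∥ x ∥ = length (supp x)

  colour : Carrier → Fin 2
  colour x = parity ⌊log₂ ∥ x ∥ ⌋

  colouring : ∀ a → Partition₂ setoid a
  colouring a = record
    { cell     = λ j x → Lift a (colour x ≡ j)
    ; respects = λ j x≈y (lift e) → lift (≡.trans (cong (parity ∘ ⌊log₂_⌋) (≡.sym (supp-length-cong x≈y))) e)
    ; covers   = λ x → colour x , lift refl
    ; disjoint = λ (lift e) (lift e′) → ≡.trans (≡.sym e) e′
    }

  _Over_ : ∀ {p} → Pred Carrier p → List I → Pred Carrier _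
  (P Over R) x = P x × (_∈ R) ⊆ (_∈ supp x)

  -- `R` plays the part of the root of a Δ-system. Maximality is stated for one further index at a
  -- time, as `escape` discards finitely many such indices.
  record Core {p} (P : Pred Carrier p) : Set (c ⊔ ℓ ⊔ i ⊔ p) where
    field
      R           : List I
      uncountable : ¬ CountableOn setoid (P Over R)
      maximal     : ∀ {u} → u ∉ R → CountableOn setoid (λ x → (P Over R) x × u ∈ supp x)

  -- Enlarge `R` while uncountably many supports contain it. It has no repetitions and lies inside a
  -- support of length at most `n`, so the fuel `suc n` is never exhausted.
  core : ∀ {p} {P : Pred Carrier p} n → (∀ {x} → P x → ∥ x ∥ ≤ n) → ¬ CountableOn setoid P → Core P
  core {P = P} n bound unc = go (suc n) [] [] (+-identityʳ _) (unc ∘ countable-⊆ setoid (λ px → px , λ ()))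
    where
    go : ∀ k R → Unique R → k + length R ≡ suc n → ¬ CountableOn setoid (P Over R) → Core P
    go zero R uR eq unc with uncountable-inhabited setoid unc
    ... | x , px , R⊆x = contradiction
      (≤-trans (≤-reflexive (≡.sym eq)) (≤-trans (unique⇒length≤ uR R⊆x) (bound px))) 1+n≰n
    go (suc k) R uR eq unc with em {P = ∃[ u ] u ∉ R × ¬ CountableOn setoid (P Over (u ∷ R))}
    ... | yes (u , u∉R , unc′) = go k (u ∷ R) (All.¬Any⇒All¬ R u∉R ∷ uR) (≡.trans (+-suc k _) eq) unc′
    ... | no none = record
      { R = R
      ; uncountable = unc
      ; maximal = λ u∉R → countable-⊆ setoid
          (λ ((px , R⊆x) , u∈x) → px , λ { (here refl) → u∈x ; (there v∈R) → R⊆x v∈R })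
          (decidable-stable em λ unc′ → none (_ , u∉R , unc′))
      }

  -- Of the uncountably many elements over `R`, only countably many have support inside `R`, and by
  -- maximality only countably many meet the finite list `L` outside `R`; some element is left.
  escape : ∀ {p} {P : Pred Carrier p} (C : Core P) (L : List I) → let open Core C in
           ∃[ x ] P x × (∃[ u ] u ∈ supp x × u ∉ R) × (∀ v → v ∈ supp x → v ∈ L → v ∈ R)
  escape {P = P} C L = decidable-stable em λ none → uncountable
    (countable-⊆ setoid (classify none)
      (countable-∪ setoid (supp-countable R) (countable-list setoid (filter ∉R? L)
        λ u∈ → maximal (proj₂ (∈-filter⁻ ∉R? {xs = L} u∈)))))
    where
    open Core C

    ∉R? : ∀ v → Dec (v ∉ R)
    ∉R? v = em

    classify : ¬ (∃[ x ] P x × (∃[ u ] u ∈ supp x × u ∉ R) × (∀ v → v ∈ supp x → v ∈ L → v ∈ R)) →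
               P Over R ⊆ (λ x → (_∈ supp x) ⊆ (_∈ R)) ∪
                          (λ x → ∃[ u ] u ∈ filter ∉R? L × (P Over R) x × u ∈ supp x)
    classify none {x} px with em {P = ∃[ u ] u ∈ supp x × u ∉ R}
    ... | no  x⊆R = inj₁ λ u∈x → decidable-stable em λ u∉R → x⊆R (_ , u∈x , u∉R)
    ... | yes new with em {P = ∃[ v ] v ∈ supp x × v ∈ L × v ∉ R}
    ...   | yes (v , v∈x , v∈L , v∉R) = inj₂ (v , ∈-filter⁺ ∉R? v∈L v∉R , px , v∈x)
    ...   | no  disjoint = contradiction
      (x , proj₁ px , new , λ _ v∈x v∈L → decidable-stable em λ v∉R → disjoint (_ , v∈x , v∈L , v∉R)) none

  module _ {a p} (X : Subset setoid p) (j : Fin 2) (mono-X : FS G X ⊆ Partition₂.cell (colouring a) j) where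
    open Subset X using (member)
    module Uniqueₛ = SetoidUnique setoid

    Σ⁺ : List⁺ Carrier → Carrier
    Σ⁺ = foldr₁ _∙_

    module _ (n : ℕ) (C : Core (member ∩ λ x → ∥ x ∥ ≡ n)) where
      open Core C

      record Chain (m k : ℕ) : Set (c ⊔ ℓ ⊔ i ⊔ p) where
        field
          F         : List⁺ Carrier
          unique    : Uniqueₛ.Unique (toList F)
          members   : All member (toList F)
          -- Distinguishes the members of F from any later choice.
          anchored  : All (λ y → ∃[ u ] u ∈ supp y × u ∈ supp (Σ⁺ F) × u ∉ R) (toList F)
          -- Certifies that the support of the sum has at least k elements.
          us        : List I
          us-unique : Unique us
          us-length : length us ≡ k
          us-fresh  : All (_∉ R) us
          us⊆supp   : All (_∈ supp (Σ⁺ F)) us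
          small     : ∥ Σ⁺ F ∥ < 2 ^ m

      module _ (m : ℕ) (j≢ : parity m ≢ j) (n<2^m : n < 2 ^ m) where

        -- Each `x` is chosen by `escape` against the support of the current sum: outside `R` its
        -- indices are new and the old ones survive. The offset is the one fresh index of the
        -- initial singleton.
        chain : ∀ k → Chain m (suc k)
        chain zero with escape C []
        ... | x , (px , x≡n) , (u , u∈x , u∉R) , _ = record
          { F         = [ x ]
          ; unique    = [] ∷ []
          ; members   = px ∷ []
          ; anchored  = (u , u∈x , u∈x , u∉R) ∷ []
          ; us        = u ∷ []
          ; us-unique = [] ∷ []
          ; us-length = refl
          ; us-fresh  = u∉R ∷ []
          ; us⊆supp   = u∈x ∷ []
          ; small     = subst (_< 2 ^ m) (≡.sym x≡n) n<2^m
          }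
        chain (suc k) = extend (chain k)
          where
          extend : Chain m (suc k) → Chain m (suc (suc k))
          extend ch with escape C (supp (Σ⁺ (Chain.F ch)))
          ... | x , (px , x≡n) , (u , u∈x , u∉R) , x∩σ⊆R = record
            { F         = F′
            ; unique    = unique′
            ; members   = members′
            ; anchored  = (u , u∈x , u∈σ′ , u∉R) ∷
                          All.map (λ (v , v∈y , v∈σ , v∉R) → v , v∈y , keep v∈σ v∉R , v∉R) anchored
            ; us        = u ∷ us
            ; us-unique = All.map (λ v∈σ u≡v → u∉σ (subst (_∈ supp σ) (≡.sym u≡v) v∈σ)) us⊆supp ∷ us-unique
            ; us-length = cong suc us-length
            ; us-fresh  = u∉R ∷ us-fresh
            ; us⊆supp   = u∈σ′ ∷ All.zipWith (λ (v∈σ , v∉R) → keep v∈σ v∉R) (us⊆supp , us-fresh)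
            -- The new sum stays below 2^(m+1). Were it at least 2^m, its logarithm would be `m`,
            -- and its colour `parity m` instead of `j`.
            ; small     = ≰⇒> λ 2^m≤ → j≢ (≡.trans
                            (cong parity (≡.sym (⌊log₂⌋-unique m 2^m≤ σ′<2^sm)))
                            (lower (mono-X (F′ , unique′ , members′ , ≈-refl))))
            }
            where
            open Chain ch
            σ  = Σ⁺ F
            F′ = x ∷⁺ F
            σ′ = x ∙ σ

            keep : ∀ {v} → v ∈ supp σ → v ∉ R → v ∈ supp σ′
            keep v∈σ v∉R = supp-∙ʳ x σ v∈σ λ v∈x → v∉R (x∩σ⊆R _ v∈x v∈σ)

            u∉σ : u ∉ supp σ
            u∉σ u∈σ = u∉R (x∩σ⊆R _ u∈x u∈σ)

            u∈σ′ : u ∈ supp σ′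
            u∈σ′ = supp-∙ˡ x σ u∈x u∉σ

            -- If `x` equalled an earlier `y`, the anchor of `y` would lie in the supports of both
            -- `x` and `σ`, yet outside `R`.
            unique′ : Uniqueₛ.Unique (toList F′)
            unique′ = All.map (λ (v , v∈y , v∈σ , v∉R) x≈y →
              v∉R (x∩σ⊆R _ (supp-cong (≈-sym x≈y) v∈y) v∈σ)) anchored ∷ unique

            members′ : All member (toList F′)
            members′ = px ∷ members

            σ′<2^sm : ∥ σ′ ∥ < 2 ^ suc m
            σ′<2^sm = begin-strict
              ∥ x ∙ σ ∥          ≤⟨ supp-length-∙ x σ ⟩
              ∥ x ∥ + ∥ σ ∥      ≡⟨ cong (_+ ∥ σ ∥) x≡n ⟩
              n + ∥ σ ∥          <⟨ +-mono-< n<2^m small ⟩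
              2 ^ m + 2 ^ m      ≡⟨ cong (2 ^ m +_) (+-identityʳ _) ⟨
              2 ^ suc m          ∎
              where open ≤-Reasoning

        -- A chain with 2^m + 1 certified indices contradicts its own bound 2^m.
        no-chain : ⊥
        no-chain = contradiction (chain (2 ^ m)) λ ch → let open Chain ch in
          <⇒≱ small (≤-trans (n≤1+n _) (≤-trans (≤-reflexive (≡.sym us-length))
            (unique⇒length≤ us-unique (All.lookup us⊆supp))))

      -- The exponents `n` and `suc n` both have powers of 2 above `n`, and one of them has the
      -- wrong parity.
      no-core : ⊥
      no-core with parity-misses j n
      ... | inj₁ ≢j = no-chain n ≢j (n<2^n n)
      ... | inj₂ ≢j = no-chain (suc n) ≢j (<-trans (n<1+n n) (n<2^n (suc n)))

    -- `X` is the union of its pieces of constant support size; an uncountable piece would have a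
    -- core.
    monochromatic⇒countable : CountableOn setoid member
    monochromatic⇒countable = countable-⊆ setoid (λ {x} px → ∥ x ∥ , px , refl)
      (countable-⋃ setoid λ n → decidable-stable em λ unc →
        no-core n (core n (λ (_ , x≡n) → ≤-reflexive x≡n) unc))

-- Transfer to setoids, and the theorem.

countableOn⇒countable : (∀ {u v} → AxiomOfChoice u v) → ∀ {c ℓ p} {S : Setoid c ℓ} (X : Subset S p) →
                        CountableOn S (Subset.member X) → Countable (Subset.asSetoid X)
countableOn⇒countable ac {S = S} X (f , inj) with ac S
... | rep , rep≈ , rep-cong = record
  -- Evaluating `f` at representatives makes it respect `_≈_`; they stay in `X` because membership
  -- does.
  { to        = λ (x , _) → f (rep x)
  ; cong      = λ x≈y → cong f (rep-cong x≈y)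
  ; injective = λ {(x , px)} {(y , py)} eq →
      trans (sym (rep≈ x)) (trans (inj (respects (sym (rep≈ x)) px) (respects (sym (rep≈ y)) py) eq) (rep≈ y))
  }
  where
  open Setoid S
  open Subset X

countable-bijection : ∀ {s t s′ t′} {S : Setoid s t} {Λ : Setoid s′ t′} → Bijection S Λ → Countable S → Countable Λ
countable-bijection {Λ = Λ} b f = record
  { to        = λ y → Injection.to f (from y)
  ; cong      = λ y≈z → Injection.cong f (injective (trans (to∘from _) (trans y≈z (sym (to∘from _)))))
  ; injective = λ eq → trans (sym (to∘from _)) (trans (to-cong (Injection.injective f eq)) (to∘from _))
  }
  where
  open Setoid Λ
  open Bijection b using (injective; surjection) renaming (cong to to-cong)
  open Surjection surjection using () renaming (to⁻ to from; to∘to⁻ to to∘from)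

theorem3p2 : (∀ {u} → ExcludedMiddle u) →
    (∀ {u v} → AxiomOfChoice u v) →
    ∀ {c ℓ a p s t} (G : CommutativeSemigroup c ℓ) →
    let open CommutativeSemigroup G in
    Cancellative _≈_ _∙_ →
    (Σ[ A ∈ Partition₂ setoid a ]
    ((X : Subset setoid p) → Uncountable (Subset.asSetoid X) →
    (i : Fin 2) → ¬ (FS G X ⊆ Partition₂.cell A i)))
    × ((Λ : Setoid s t) → Uncountable Λ → ¬ Hind G a p Λ)
theorem3p2 em ac {a = a} {p} G cancel =
  (colouring a , avoids) , λ Λ unc hind → let X , bij , i , mono = hind (colouring a) in
    avoids X (unc ∘ countable-bijection bij) i mono
  where
  open CommutativeSemigroup G using (setoid)
  open Colouring em G (finiteSupport em ac G cancel)

  avoids : (X : Subset setoid p) → Uncountable (Subset.asSetoid X) →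
           (i : Fin 2) → ¬ (FS G X ⊆ Partition₂.cell (colouring a) i)
  avoids X unc i mono = unc (countableOn⇒countable ac X (monochromatic⇒countable X i mono))
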